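{- Let $n,x$ be integers with $1<x<n$, so that $G=C_{2n}(x,1,n)$ is a $5$-regular circulant graph. If $x=\tfrac{n}{2}$, then $G$ is word-representable and $R(G)\leq 5$.
   Context: Two distinct letters $x,y$ alternate in a word $w$ if, after deleting all other letters from $w$, the resulting word is of the form $xyxy\cdots$ or $yxyx\cdots$ (of even or odd length). A graph $G=(V,E)$ is word-representable if there is a word $w$ over the alphabet $V$, containing every letter of $V$ at least once, such that for all distinct $x,y\in V$, $xy\in E$ if and only if $x$ and $y$ alternate in $w$. A word is $k$-uniform if every letter occurs in it exactly $k$ times; $G$ is $k$-representable if some $k$-uniform word represents it, and the representation number $R(G)$ of a word-representable graph $G$ is the least such $k$. For an integer $m$ and a set $R$ of positive integers each at most $m/2$, the circulant graph $C_m(R)$ has vertex set $\{0,1,\dots,m-1\}$, with $i$ and $j$ adjacent iff $\min(|i-j|,\,m-|i-j|)\in R$. $C_{2n}(x,1,n)$ denotes the circulant graph on $2n$ vertices with jump set $\{1,x,n\}$; it is $5$-regular exactly when $1<x<n$. -}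

module Defs where

open import Data.Fin.Base using (Fin; toℕ)
open import Data.Fin.Properties using (_≟_)
open import Data.List.Base using (List; []; _∷_; filter; length)
open import Data.List.Membership.Propositional using (_∈_)
open import Data.List.Relation.Unary.All using (All; []; _∷_; lookup)
open import Data.Nat.Base using (ℕ; _*_; _∸_; _⊓_; _≤_; _<_; ∣_-_∣)
open import Data.Nat.Properties
  using (≤-refl; ≤-trans; <⇒≤; *-monoʳ-≤; ∣-∣-comm; ∣n-n∣≡0; n≮0)
open import Data.Product.Base using (_×_; _,_; ∃-syntax; proj₁)
open import Data.Sum.Base using (_⊎_)
open import Function.Bundles using (_⇔_)
open import Level using (0ℓ)
open import Relation.Binary.Core using (Rel)
open import Relation.Binary.Definitions using (Symmetric)
open import Relation.Binary.PropositionalEquality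
  using (_≡_; _≢_; subst)
open import Relation.Nullary.Decidable using (_⊎-dec_)
open import Relation.Nullary.Negation using (¬_)

record Graph : Set₁ where
  field
    order  : ℕ
    Adj    : Rel (Fin order) 0ℓ
    sym    : Symmetric Adj
    irrefl : ∀ {v} → ¬ Adj v v

  Vertex : Set
  Vertex = Fin order

  Word : Set
  Word = List Vertex

open Graph using (Adj; Word)

restrict : ∀ {N} → Fin N → Fin N → List (Fin N) → List (Fin N)
restrict a b = filter (λ c → (c ≟ a) ⊎-dec (c ≟ b))

-- The words  a b a b ⋯  of any length, starting with the first index.
data Alternating {A : Set} : A → A → List A → Set where
  []  : ∀ {a b} → Alternating a b []
  _∷_ : ∀ a {b w} → Alternating b a w → Alternating a b (a ∷ w)

Alternate : ∀ {N} → Fin N → Fin N → List (Fin N) → Set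
Alternate a b w =
  Alternating a b (restrict a b w) ⊎ Alternating b a (restrict a b w)

Represents : (G : Graph) → Word G → Set
Represents G w =
  (∀ v → v ∈ w) × (∀ a b → a ≢ b → Adj G a b ⇔ Alternate a b w)

WordRepresentable : Graph → Set
WordRepresentable G = ∃[ w ] Represents G w

occurrences : ∀ {N} → Fin N → List (Fin N) → ℕ
occurrences v w = length (filter (_≟ v) w)

Uniform : ∀ {N} → ℕ → List (Fin N) → Set
Uniform k w = ∀ v → occurrences v w ≡ k

Representable : ℕ → Graph → Set
Representable k G = ∃[ w ] Uniform k w × Represents G w

-- R(G) is a relation rather than a function of G, because it is defined only
-- for word-representable G.
IsRepresentationNumber : Graph → ℕ → Set
IsRepresentationNumber G r =
  Representable r G × (∀ k → Representable k G → r ≤ k)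

circularDistance : ∀ {m} → Fin m → Fin m → ℕ
circularDistance {m} i j = ∣ toℕ i - toℕ j ∣ ⊓ (m ∸ ∣ toℕ i - toℕ j ∣)

-- 2 * r ≤ m  expresses  r ≤ m/2  without rounding.
IsJump : ℕ → ℕ → Set
IsJump m r = 1 ≤ r × 2 * r ≤ m

circulant : (m : ℕ) (R : List ℕ) → All (IsJump m) R → Graph
circulant m R jumps = record
  { order  = m
  ; Adj    = λ i j → circularDistance i j ∈ R
  ; sym    = λ {i} {j} →
      subst (λ d → d ⊓ (m ∸ d) ∈ R) (∣-∣-comm (toℕ i) (toℕ j))
  ; irrefl = λ {i} d∈R → n≮0 (subst (λ d → 1 ≤ d ⊓ (m ∸ d))
      (∣n-n∣≡0 (toℕ i)) (proj₁ (lookup jumps d∈R)))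
  }

C₂ₙ[_,1,_] : (x n : ℕ) → 1 < x → x < n → Graph
C₂ₙ[ x ,1, n ] 1<x x<n = circulant (2 * n) (x ∷ 1 ∷ n ∷ [])
  ( (1≤x , *-monoʳ-≤ 2 (<⇒≤ x<n))
  ∷ (≤-refl , *-monoʳ-≤ 2 (≤-trans 1≤x (<⇒≤ x<n)))
  ∷ (≤-trans 1≤x (<⇒≤ x<n) , ≤-refl)
  ∷ [])
  where
  1≤x : 1 ≤ x
  1≤x = <⇒≤ 1<x

{-# OPTIONS --safe #-}
-- Write m = 2n = 4x. The representing word is the concatenation, for s running
-- through ℤ/m, of the blocks (s+2x)(s+3x)(s+1)(s)(s+x+1). Going from block v−1
-- to block v, the letters strictly between the two occurrences of v are exactly
-- its five neighbours, so v alternates with no other letter; the one vertex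
-- whose two blocks are separated by the cut of the cyclic word is handled by
-- exchanging the two vertices. Conversely, the word restricted to a coset of
-- ⟨x⟩ cycles through r, r+x, r+2x, r+3x, so these letters alternate pairwise;
-- and v, v+1 alternate because v+1 always stands five places after v, while
-- two occurrences of v are at least six places apart.
-- The least k is found by search, as the k-uniform words on m letters are finite in number.
module Submission where

open import Defs
open import Data.Empty using (⊥-elim)
open import Data.Fin.Base using (Fin; zero; suc; toℕ)
open import Data.Fin.Patterns
open import Data.Fin.Properties
  using (_≟_; any?; all?; toℕ<n; toℕ-injective; toℕ-fromℕ<)
open import Data.List.Base
  using (List; []; _∷_; [_]; filter; length; applyUpTo; allFin)
open import Data.List.Membership.DecPropositional using (_∈?_)
open import Data.List.Membership.Propositional using (_∈_; _∉_)
open import Data.List.Membership.Propositional.Properties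
  using (∈-applyUpTo⁺; ∈-allFin; ∈-filter⁻)
open import Data.List.Properties
  using (filter-accept; filter-reject; filter-++; filter-≐; length-++; ∷-injectiveˡ; length-tabulate)
open import Data.List.Relation.Unary.All using (All; []; _∷_)
import Data.List.Relation.Unary.All as All
open import Data.List.Relation.Unary.AllPairs using ([]; _∷_)
open import Data.List.Relation.Unary.Any using (here; there)
open import Data.List.Relation.Unary.Unique.Propositional using (Unique)
open import Data.List.Relation.Unary.Unique.Propositional.Properties using (applyUpTo⁺₁)
open import Data.Nat.Base
open import Data.Nat.DivMod
open import Data.Nat.Divisibility using (∣⇒≤; m%n≡0⇒n∣m)
open import Data.Nat.Properties hiding (_≟_)
import Data.Nat.Properties as ℕ
open import Data.Nat.Tactic.RingSolver using (solve-∀)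
open import Data.Product.Base using (_×_; _,_; ∃-syntax; proj₁; proj₂; map₂)
open import Data.Product.Properties using (≡-dec)
open import Data.Sum.Base using (_⊎_; inj₁; inj₂; swap)
import Data.Sum.Base as Sum
open import Function.Base using (_∘_; id)
open import Function.Bundles using (_⇔_; mk⇔; Equivalence)
open import Relation.Binary.PropositionalEquality
  using (_≡_; _≢_; refl; sym; trans; cong; cong₂; subst; subst₂; module ≡-Reasoning)
open import Relation.Nullary.Decidable
  using (Dec; yes; no; map′; from-yes; ¬?; _×-dec_; _⊎-dec_; _→-dec_)
open import Relation.Nullary.Negation using (¬_; contradiction)
open import Relation.Unary using (Decidable)

open Graph using (Adj)

-- Alternation expressed by positions in a word.

Separated : {A : Set} → (ℕ → A) → ℕ → A → A → Set
Separated g M a b = ∀ {i j} → i < j → j < M → g i ≡ a → g j ≡ a →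
  ∃[ k ] i < k × k < j × g k ≡ b

module _ {N : ℕ} {a b : Fin N} where

  private
    restrict-keep : ∀ {c} w → c ≡ a ⊎ c ≡ b → restrict a b (c ∷ w) ≡ c ∷ restrict a b w
    restrict-keep w = filter-accept (λ c → (c ≟ a) ⊎-dec (c ≟ b)) {xs = w}

    restrict-drop : ∀ {c} w → ¬ (c ≡ a ⊎ c ≡ b) → restrict a b (c ∷ w) ≡ restrict a b w
    restrict-drop w = filter-reject (λ c → (c ≟ a) ⊎-dec (c ≟ b)) {xs = w}

    restrict-head : ∀ g M {c r} → restrict a b (applyUpTo g M) ≡ c ∷ r →
      ∃[ i ] i < M × g i ≡ c × (∀ k → k < i → ¬ (g k ≡ a ⊎ g k ≡ b))
    restrict-head g (suc M) eq with (g 0 ≟ a) ⊎-dec (g 0 ≟ b)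
    ... | yes p = 0 , z<s , ∷-injectiveˡ (trans (sym (restrict-keep _ p)) eq) , λ _ ()
    ... | no ¬p with i , i<M , gi , no-earlier ←
      restrict-head (g ∘ suc) M (trans (sym (restrict-drop _ ¬p)) eq) =
      suc i , s<s i<M , gi , λ { zero _ → ¬p ; (suc k) (s<s k<i) → no-earlier k k<i }

    separated-tail : ∀ {g : ℕ → Fin N} {M c d} →
      Separated g (suc M) c d → Separated (g ∘ suc) M c d
    separated-tail sep i<j j<M gi gj with sep (s<s i<j) (s<s j<M) gi gj
    ... | suc k , s<s i<k , s<s k<j , gk = k , i<k , k<j , gk

    -- If the restricted tail began with `c` again, separation would put a `d` strictly before that
    -- `c`, contradicting that it is the first kept letter of the tail. So the tail begins with `d`
    -- or is empty.
    prepend : ∀ g M {c d} → (∀ {k} → g k ≡ d → g k ≡ a ⊎ g k ≡ b) → c ≡ g 0 →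
      Separated g (suc M) c d →
      ∀ {w} → restrict a b (applyUpTo (g ∘ suc) M) ≡ w →
      Alternating c d w ⊎ Alternating d c w → Alternating c d (c ∷ w)
    prepend g M d-kept c≡g0 sep eq (inj₂ alt) = _ ∷ alt
    prepend g M d-kept c≡g0 sep eq (inj₁ []) = _ ∷ []
    prepend g M d-kept c≡g0 sep eq (inj₁ (c ∷ alt))
      with i , i<M , gi , no-earlier ← restrict-head (g ∘ suc) M eq
      with sep z<s (s<s i<M) (sym c≡g0) gi
    ... | suc k , _ , s<s k<i , gk = ⊥-elim (no-earlier k k<i (d-kept gk))

  separated⇒alternate : ∀ g M → Separated g M a b → Separated g M b a →
    Alternate a b (applyUpTo g M)
  separated⇒alternate g zero _ _ = inj₁ []
  separated⇒alternate g (suc M) sep sep′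
    with ih ← separated⇒alternate (g ∘ suc) M (separated-tail {g} sep) (separated-tail {g} sep′)
    with g 0 ≟ a | g 0 ≟ b
  ... | yes refl | _ = inj₁ (prepend g M inj₂ refl sep refl ih)
  ... | no _ | yes refl = inj₂ (prepend g M inj₁ refl sep′ refl (swap ih))
  ... | no _ | no _ = ih

  module _ (a≢b : a ≢ b) where

    private
      separated-head : ∀ g M → Alternating b a (restrict a b (applyUpTo g M)) →
        ∀ {j} → j < M → g j ≡ a → ∃[ k ] k < j × g k ≡ b
      separated-head g (suc M) alt {j} j<M gj with g 0 ≟ a | g 0 ≟ b
      separated-head g (suc M) alt {zero} j<M gj | no ¬p | no _ = contradiction gj ¬p
      separated-head g (suc M) alt {suc j} (s<s j<M) gj | no _ | no _
        with k , k<j , gk ← separated-head (g ∘ suc) M alt j<M gj = suc k , s<s k<j , gk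
      separated-head g (suc M) alt {zero} j<M gj | no _ | yes q = contradiction (trans (sym gj) q) a≢b
      separated-head g (suc M) alt {suc j} j<M gj | no _ | yes q = 0 , z<s , q
      separated-head g (suc M) (_ ∷ _) j<M gj | yes refl | _ = ⊥-elim (a≢b refl)

    -- Letters are dropped until the earlier `a` stands at the head. Then the rest of the
    -- restriction has to begin with `b`, and `separated-head` finds a `b` before the later `a`.
    alternate⇒separated : ∀ g M → Alternate a b (applyUpTo g M) → Separated g M a b
    alternate⇒separated g (suc M) alt {zero} {suc j} i<j (s<s j<M) gi gj =
      let k , k<j , gk = separated-head (g ∘ suc) M (rest alt) j<M gj in
      suc k , z<s , s<s k<j , gk
      where
      rest : Alternate a b (applyUpTo g (suc M)) →
             Alternating b a (restrict a b (applyUpTo (g ∘ suc) M))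
      rest alt rewrite restrict-keep (applyUpTo (g ∘ suc) M) (inj₁ gi) with alt
      ... | inj₁ (_ ∷ alt′) = alt′
      ... | inj₂ (_ ∷ _) = contradiction (sym gi) a≢b
    alternate⇒separated g (suc M) alt {suc i} {suc j} (s<s i<j) (s<s j<M) gi gj =
      let k , i<k , k<j , gk = alternate⇒separated (g ∘ suc) M (rest alt) i<j j<M gi gj in
      suc k , s<s i<k , s<s k<j , gk
      where
      rest : Alternate a b (applyUpTo g (suc M)) → Alternate a b (applyUpTo (g ∘ suc) M)
      rest alt with (g 0 ≟ a) ⊎-dec (g 0 ≟ b)
      ... | no ¬p rewrite restrict-drop (applyUpTo (g ∘ suc) M) ¬p = alt
      ... | yes p rewrite restrict-keep (applyUpTo (g ∘ suc) M) p with alt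
      ... | inj₁ (_ ∷ alt′) = inj₂ alt′
      ... | inj₂ (_ ∷ alt′) = inj₁ alt′

-- The two restrictions filter by predicates that differ in the order of the disjuncts, so they
-- agree only up to a proof and not by computation.
alternate-sym : ∀ {N} {a b : Fin N} w → Alternate a b w → Alternate b a w
alternate-sym {a = a} {b} w alt
  rewrite filter-≐ (λ c → (c ≟ b) ⊎-dec (c ≟ a)) (λ c → (c ≟ a) ⊎-dec (c ≟ b)) (swap , swap) w
  = swap alt

-- Counting occurrences and bounded search for the representation number.

alternating? : ∀ {N} (a b : Fin N) w → Dec (Alternating a b w)
alternating? a b [] = yes []
alternating? a b (c ∷ w) with c ≟ a
... | no c≢a = no λ { (_ ∷ _) → c≢a refl }
... | yes refl = map′ (a ∷_) (λ { (_ ∷ alt) → alt }) (alternating? b a w)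

occurrences-∷ : ∀ {N} (v c : Fin N) w →
  occurrences v (c ∷ w) ≡ occurrences v [ c ] + occurrences v w
occurrences-∷ v c w = trans (cong length (filter-++ (_≟ v) [ c ] w)) (length-++ (filter (_≟ v) [ c ]))

occurrences-absent : ∀ {N} {v : Fin N} {w} → v ∉ w → occurrences v w ≡ 0
occurrences-absent {w = []} v∉w = refl
occurrences-absent {v = v} {c ∷ w} v∉w with c ≟ v
... | yes refl = contradiction (here refl) v∉w
... | no _ = occurrences-absent (v∉w ∘ there)

occurrences-unique : ∀ {N} {v : Fin N} {w} → Unique w → v ∈ w → occurrences v w ≡ 1
occurrences-unique {v = v} {c ∷ w} (c≢w ∷ uw) v∈ with c ≟ v
... | yes refl = cong suc (occurrences-absent λ v∈w → All.lookup c≢w v∈w refl)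
occurrences-unique (c≢w ∷ uw) (here refl) | no c≢v = contradiction refl c≢v
occurrences-unique (c≢w ∷ uw) (there v∈w) | no _ = occurrences-unique uw v∈w

-- Induction on `vs`: deleting every copy of `v` shortens the word by at most `k`. The bound makes
-- the search for a `k`-uniform word finite.
length-bound : ∀ {N k} (vs w : List (Fin N)) → (∀ c → c ∈ w → c ∈ vs) →
  (∀ v → occurrences v w ≤ k) → length w ≤ length vs * k
length-bound [] [] _ _ = z≤n
length-bound [] (c ∷ w) w⊆ _ with () ← w⊆ c (here refl)
length-bound {N} {k} (v ∷ vs) w w⊆ occ≤ = begin
  length w                               ≡⟨ split w ⟩
  occurrences v w + length (others w)    ≤⟨ +-mono-≤ (occ≤ v)
    (length-bound vs (others w) others⊆ λ u → ≤-trans (occ-others u w) (occ≤ u)) ⟩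
  k + length vs * k                      ∎
  where
  open ≤-Reasoning
  others : List (Fin N) → List (Fin N)
  others = filter (¬? ∘ (_≟ v))

  split : ∀ w → length w ≡ occurrences v w + length (others w)
  split [] = refl
  split (c ∷ w) with c ≟ v
  ... | yes _ = cong suc (split w)
  ... | no _ = trans (cong suc (split w)) (sym (+-suc _ _))

  occ-others : ∀ u w → occurrences u (others w) ≤ occurrences u w
  occ-others u [] = z≤n
  occ-others u (c ∷ w) with c ≟ v
  occ-others u (c ∷ w) | yes _ with c ≟ u
  ... | yes _ = m≤n⇒m≤1+n (occ-others u w)
  ... | no _ = occ-others u w
  occ-others u (c ∷ w) | no _ with c ≟ u
  ... | yes _ = s≤s (occ-others u w)
  ... | no _ = occ-others u w

  others⊆ : ∀ c → c ∈ others w → c ∈ vs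
  others⊆ c c∈ with c∈w , c≢v ← ∈-filter⁻ (¬? ∘ (_≟ v)) {xs = w} c∈ with w⊆ c c∈w
  ... | here c≡v = contradiction c≡v c≢v
  ... | there c∈vs = c∈vs

uniform-length : ∀ {N k} (w : List (Fin N)) → Uniform k w → length w ≤ N * k
uniform-length {N} {k} w uni = subst (λ l → length w ≤ l * k) (length-tabulate {n = N} id)
  (length-bound (allFin N) w (λ c _ → ∈-allFin c) (≤-reflexive ∘ uni))

-- The search branches on the first letter, of which there are finitely many, and passes the
-- property `Q ∘ (c ∷_)` on to the shorter remainder.
∃-bounded? : ∀ {N} {Q : List (Fin N) → Set} → Decidable Q → ∀ L →
  Dec (∃[ w ] length w ≤ L × Q w)
∃-bounded? {Q = Q} Q? L with Q? []
... | yes q = yes ([] , z≤n , q)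
∃-bounded? Q? zero | no ¬q = no λ { ([] , _ , q) → ¬q q }
∃-bounded? Q? (suc L) | no ¬q = map′
  (λ (c , w , w≤L , q) → c ∷ w , s≤s w≤L , q)
  (λ { ([] , _ , q) → contradiction q ¬q ; (c ∷ w , s≤s w≤L , q) → c , w , w≤L , q })
  (any? λ c → ∃-bounded? (Q? ∘ (c ∷_)) L)

module _ (G : Graph) (adj? : ∀ u v → Dec (Adj G u v)) where

  represents? : ∀ w → Dec (Represents G w)
  represents? w = all? (λ v → _∈?_ _≟_ v w) ×-dec
    all? λ a → all? λ b → ¬? (a ≟ b) →-dec
      map′ (λ (to , from) → mk⇔ to from) (λ eq → Equivalence.to eq , Equivalence.from eq)
        ((adj? a b →-dec alternate? a b) ×-dec (alternate? a b →-dec adj? a b))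
    where
    alternate? : ∀ a b → Dec (Alternate a b w)
    alternate? a b = alternating? a b (restrict a b w) ⊎-dec alternating? b a (restrict a b w)

  representable? : ∀ k → Dec (Representable k G)
  representable? k = map′ (map₂ proj₂)
    (λ (w , uni , rep) → w , uniform-length w uni , uni , rep)
    (∃-bounded? (λ w → all? (λ v → occurrences v w ℕ.≟ k) ×-dec represents? w) (Graph.order G * k))

-- The values 0, 1, ... are tried in turn, with `P` shifted by one at each step; the known witness
-- `n` both ends the recursion and bounds the result.
least : ∀ {P : ℕ → Set} → Decidable P → ∀ n → P n →
  ∃[ r ] (P r × (∀ k → P k → r ≤ k)) × r ≤ n
least P? n p with P? 0
... | yes p₀ = 0 , (p₀ , λ _ _ → z≤n) , z≤n
least P? zero p | no ¬p₀ = contradiction p ¬p₀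
least P? (suc n) p | no ¬p₀ =
  let r , (pr , r-least) , r≤n = least (P? ∘ suc) n p in
  suc r , (pr , λ { zero p₀ → contradiction p₀ ¬p₀ ; (suc k) pk → s≤s (r-least k pk) }) , s≤s r≤n

-- Residues modulo `m`, rotations and circular distance.

module Modular (m : ℕ) .{{_ : NonZero m}} where

  %-cong-+ʳ : ∀ p q c → p % m ≡ q % m → (p + c) % m ≡ (q + c) % m
  %-cong-+ʳ p q c eq = begin
    (p + c) % m              ≡⟨ %-distribˡ-+ p c m ⟩
    (p % m + c % m) % m      ≡⟨ cong (λ r → (r + c % m) % m) eq ⟩
    (q % m + c % m) % m      ≡⟨ %-distribˡ-+ q c m ⟨
    (q + c) % m              ∎
    where open ≡-Reasoning

  -- Adding `c * pred m` undoes the addition of `c`, since together they add the multiple `c * m`.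
  %-cancel-+ʳ : ∀ p q c → (p + c) % m ≡ (q + c) % m → p % m ≡ q % m
  %-cancel-+ʳ p q c eq = begin
    p % m                          ≡⟨ undo p ⟨
    (p + c + c * pred m) % m       ≡⟨ %-cong-+ʳ (p + c) (q + c) (c * pred m) eq ⟩
    (q + c + c * pred m) % m       ≡⟨ undo q ⟩
    q % m                          ∎
    where
    open ≡-Reasoning
    undo : ∀ r → (r + c + c * pred m) % m ≡ r % m
    undo r = begin
      (r + c + c * pred m) % m     ≡⟨ cong (_% m) (+-assoc r c (c * pred m)) ⟩
      (r + (c + c * pred m)) % m   ≡⟨ cong (λ t → (r + t) % m) (*-suc c (pred m)) ⟨
      (r + c * suc (pred m)) % m   ≡⟨ cong (λ t → (r + c * t) % m) (suc-pred m) ⟩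
      (r + c * m) % m              ≡⟨ [m+kn]%n≡m%n r c m ⟩
      r % m                        ∎

  toℕ-mod : ∀ k → toℕ (k mod m) ≡ k % m
  toℕ-mod k = toℕ-fromℕ< (m%n<n k m)

  %⇒mod : ∀ p q → p % m ≡ q % m → p mod m ≡ q mod m
  %⇒mod p q eq = toℕ-injective (trans (toℕ-mod p) (trans eq (sym (toℕ-mod q))))

  mod⇒% : ∀ p q → p mod m ≡ q mod m → p % m ≡ q % m
  mod⇒% p q eq = trans (sym (toℕ-mod p)) (trans (cong toℕ eq) (toℕ-mod q))

  mod-toℕ : (a : Fin m) → toℕ a mod m ≡ a
  mod-toℕ a = toℕ-injective (trans (toℕ-mod (toℕ a)) (m<n⇒m%n≡m (toℕ<n a)))

  shift : ℕ → Fin m → Fin m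
  shift δ a = (toℕ a + δ) mod m

  shift-mod : ∀ δ k → shift δ (k mod m) ≡ (k + δ) mod m
  shift-mod δ k = %⇒mod _ _ (%-cong-+ʳ (toℕ (k mod m)) k δ (trans (cong (_% m) (toℕ-mod k)) (m%n%n≡m%n k m)))

  shift-shift : ∀ δ ε a → shift δ (shift ε a) ≡ shift (ε + δ) a
  shift-shift δ ε a = trans (shift-mod δ (toℕ a + ε)) (cong (_mod m) (+-assoc (toℕ a) ε δ))

  shift-comm : ∀ δ ε a → shift δ (shift ε a) ≡ shift ε (shift δ a)
  shift-comm δ ε a = trans (shift-shift δ ε a)
    (trans (cong (λ t → shift t a) (+-comm ε δ)) (sym (shift-shift ε δ a)))

  shift-full : ∀ a → shift m a ≡ a
  shift-full a = trans (%⇒mod _ _ ([m+n]%n≡m%n (toℕ a) m)) (mod-toℕ a)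

  shift-back : ∀ δ ε {a b} → δ + ε ≡ m → shift δ a ≡ b → shift ε b ≡ a
  shift-back δ ε {a} δ+ε≡m refl = trans (shift-shift ε δ a)
    (trans (cong (λ t → shift t a) δ+ε≡m) (shift-full a))

  shift-injective : ∀ δ {a b} → shift δ a ≡ shift δ b → a ≡ b
  shift-injective δ {a} {b} eq = begin
    a               ≡⟨ mod-toℕ a ⟨
    toℕ a mod m     ≡⟨ %⇒mod (toℕ a) (toℕ b) (%-cancel-+ʳ (toℕ a) (toℕ b) δ (mod⇒% _ _ eq)) ⟩
    toℕ b mod m     ≡⟨ mod-toℕ b ⟩
    b               ∎
    where open ≡-Reasoning

  -- The representatives differ by `δ` if the rotation does not pass 0, and by `m ∸ δ` if it does.
  -- Both give the same minimum, which is `δ` because `2 * δ ≤ m`.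
  circularDistance-shift : ∀ {δ} {a b : Fin m} → 2 * δ ≤ m → shift δ a ≡ b →
    circularDistance a b ≡ δ
  circularDistance-shift {δ} {a} {b} 2δ≤m refl with toℕ a + δ <? m
  ... | yes a+δ<m
    rewrite trans (toℕ-mod (toℕ a + δ)) (m<n⇒m%n≡m a+δ<m) | ∣m-m+n∣≡n (toℕ a) δ
    = m≤n⇒m⊓n≡m (m+n≤o⇒m≤o∸n δ (subst (_≤ m) (cong (δ +_) (+-identityʳ δ)) 2δ≤m))
  ... | no a+δ≮m = begin
    d ⊓ (m ∸ d)                ≡⟨ cong (λ d → d ⊓ (m ∸ d)) d≡ ⟩
    (m ∸ δ) ⊓ (m ∸ (m ∸ δ))    ≡⟨ cong ((m ∸ δ) ⊓_) (m∸[m∸n]≡n δ≤m) ⟩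
    (m ∸ δ) ⊓ δ                ≡⟨ m≥n⇒m⊓n≡n (m+n≤o⇒m≤o∸n δ 2δ≤m′) ⟩
    δ                          ∎
    where
    open ≡-Reasoning
    d : ℕ
    d = ∣ toℕ a - toℕ (shift δ a) ∣
    2δ≤m′ : δ + δ ≤ m
    2δ≤m′ = subst (_≤ m) (cong (δ +_) (+-identityʳ δ)) 2δ≤m
    δ≤m : δ ≤ m
    δ≤m = m+n≤o⇒m≤o δ 2δ≤m′
    m≤a+δ : m ≤ toℕ a + δ
    m≤a+δ = ≮⇒≥ a+δ≮m
    b≡ : toℕ (shift δ a) ≡ toℕ a + δ ∸ m
    b≡ = trans (toℕ-mod (toℕ a + δ)) (trans (sym (m≤n⇒[n∸m]%m≡n%m m≤a+δ))
      (m<n⇒m%n≡m (m<n+o⇒m∸n<o (toℕ a + δ) m (+-mono-<-≤ (toℕ<n a) δ≤m))))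
    a≡ : toℕ a ≡ toℕ (shift δ a) + (m ∸ δ)
    a≡ = +-cancelʳ-≡ δ _ _ (begin
      toℕ a + δ                              ≡⟨ m∸n+n≡m m≤a+δ ⟨
      toℕ a + δ ∸ m + m                      ≡⟨ cong₂ _+_ b≡ (m∸n+n≡m δ≤m) ⟨
      toℕ (shift δ a) + (m ∸ δ + δ)          ≡⟨ +-assoc (toℕ (shift δ a)) (m ∸ δ) δ ⟨
      toℕ (shift δ a) + (m ∸ δ) + δ          ∎)
    d≡ : d ≡ m ∸ δ
    d≡ = trans (cong (λ t → ∣ t - toℕ (shift δ a) ∣) a≡)
      (trans (∣-∣-comm (toℕ (shift δ a) + (m ∸ δ)) (toℕ (shift δ a)))
        (∣m-m+n∣≡n (toℕ (shift δ a)) (m ∸ δ)))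

  circularDistance-sym : (a b : Fin m) → circularDistance a b ≡ circularDistance b a
  circularDistance-sym a b = cong (λ d → d ⊓ (m ∸ d)) (∣-∣-comm (toℕ a) (toℕ b))

  private
    shift-distance-≤ : ∀ {a b : Fin m} → toℕ a ≤ toℕ b →
      let δ = circularDistance a b in shift δ a ≡ b ⊎ shift δ b ≡ a
    shift-distance-≤ {a} {b} a≤b rewrite m≤n⇒∣m-n∣≡n∸m a≤b
      with ⊓-sel (toℕ b ∸ toℕ a) (m ∸ (toℕ b ∸ toℕ a))
    ... | inj₁ eq rewrite eq | m+[n∸m]≡n a≤b = inj₁ (mod-toℕ b)
    ... | inj₂ eq rewrite eq = inj₂ (trans (%⇒mod _ _ (begin
      (toℕ b + (m ∸ e)) % m             ≡⟨ cong (λ t → (t + (m ∸ e)) % m) (m+[n∸m]≡n a≤b) ⟨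
      (toℕ a + e + (m ∸ e)) % m         ≡⟨ cong (_% m) (+-assoc (toℕ a) e (m ∸ e)) ⟩
      (toℕ a + (e + (m ∸ e))) % m       ≡⟨ cong (λ t → (toℕ a + t) % m) (m+[n∸m]≡n e≤m) ⟩
      (toℕ a + m) % m                   ≡⟨ [m+n]%n≡m%n (toℕ a) m ⟩
      toℕ a % m                         ∎)) (mod-toℕ a))
      where
      open ≡-Reasoning
      e : ℕ
      e = toℕ b ∸ toℕ a
      e≤m : e ≤ m
      e≤m = ≤-trans (m∸n≤m (toℕ b) (toℕ a)) (<⇒≤ (toℕ<n b))

  shift-distance : (a b : Fin m) →
    let δ = circularDistance a b in shift δ a ≡ b ⊎ shift δ b ≡ a
  shift-distance a b with ≤-total (toℕ a) (toℕ b)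
  ... | inj₁ a≤b = shift-distance-≤ a≤b
  ... | inj₂ b≤a rewrite circularDistance-sym a b = swap (shift-distance-≤ b≤a)

  -- Adjacency by directed jumps instead of distances: this form is visibly invariant under
  -- rotation, so a fact about one block carries over to all blocks.
  Near : List ℕ → Fin m → Fin m → Set
  Near R a b = ∃[ δ ] δ ∈ R × (shift δ a ≡ b ⊎ shift δ b ≡ a)

  near-shift : ∀ {R a b} ε → Near R a b → Near R (shift ε a) (shift ε b)
  near-shift ε (δ , δ∈R , step) = δ , δ∈R , Sum.map moved moved step
    where
    moved : ∀ {c d} → shift δ c ≡ d → shift δ (shift ε c) ≡ shift ε d
    moved {c} eq = trans (shift-comm δ ε c) (cong (shift ε) eq)

  near-sym : ∀ {R a b} → Near R a b → Near R b a
  near-sym (δ , δ∈R , step) = δ , δ∈R , swap step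

  near⇒distance : ∀ {R} → All (λ δ → 2 * δ ≤ m) R → ∀ {a b} → Near R a b → circularDistance a b ∈ R
  near⇒distance {R} jumps (δ , δ∈R , inj₁ step) =
    subst (_∈ R) (sym (circularDistance-shift (All.lookup jumps δ∈R) step)) δ∈R
  near⇒distance {R} jumps {a} {b} (δ , δ∈R , inj₂ step) = subst (_∈ R)
    (sym (trans (circularDistance-sym a b) (circularDistance-shift (All.lookup jumps δ∈R) step))) δ∈R

  -- Translation by `k` is a bijection of ℤ/m. The preimage `source` of `v` is v - k, with -1
  -- written as `pred m`.
  occurrences-progression : ∀ k {f : ℕ → Fin m} → (∀ s → f s ≡ (s + k) mod m) →
    ∀ v → occurrences v (applyUpTo f m) ≡ 1
  occurrences-progression k {f} f≡ v = occurrences-unique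
    (applyUpTo⁺₁ f m λ i<j j<m fi≡fj → <⇒≢ i<j (injective (<-trans i<j j<m) j<m fi≡fj))
    (subst (_∈ applyUpTo f m) f-source (∈-applyUpTo⁺ f (toℕ<n source)))
    where
    injective : ∀ {i j} → i < m → j < m → f i ≡ f j → i ≡ j
    injective {i} {j} i<m j<m eq = begin
      i        ≡⟨ m<n⇒m%n≡m i<m ⟨
      i % m    ≡⟨ %-cancel-+ʳ i j k (mod⇒% (i + k) (j + k) (trans (sym (f≡ i)) (trans eq (f≡ j)))) ⟩
      j % m    ≡⟨ m<n⇒m%n≡m j<m ⟩
      j        ∎
      where open ≡-Reasoning
    source : Fin m
    source = shift (k * pred m) v
    f-source : f (toℕ source) ≡ v
    f-source = begin
      f (toℕ source)                 ≡⟨ f≡ (toℕ source) ⟩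
      shift k source                 ≡⟨ shift-shift k (k * pred m) v ⟩
      shift (k * pred m + k) v       ≡⟨ cong (λ t → shift t v) (+-comm (k * pred m) k) ⟩
      shift (k + k * pred m) v       ≡⟨ cong (λ t → shift t v) (*-suc k (pred m)) ⟨
      shift (k * suc (pred m)) v     ≡⟨ cong (λ t → shift (k * t) v) (suc-pred m) ⟩
      shift (k * m) v                ≡⟨ %⇒mod (toℕ v + k * m) (toℕ v) ([m+kn]%n≡m%n (toℕ v) k m) ⟩
      toℕ v mod m                    ≡⟨ mod-toℕ v ⟩
      v                              ∎
      where open ≡-Reasoning

-- The word is read as `M` rows of five letters and counted by columns, because each column of the
-- representing word is an arithmetic progression.
occurrences-columns : ∀ {N} (v : Fin N) (g : ℕ → Fin N) M →
  let column = λ j → occurrences v (applyUpTo (λ s → g (s * 5 + j)) M) in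
  occurrences v (applyUpTo g (M * 5)) ≡ column 0 + (column 1 + (column 2 + (column 3 + column 4)))
occurrences-columns v g zero = refl
occurrences-columns {N} v g (suc M) = begin
  occurrences v (applyUpTo g (suc M * 5))
    ≡⟨ peel (g 0) _ (peel (g 1) _ (peel (g 2) _ (peel (g 3) _ (peel (g 4) _
         (occurrences-columns v (g ∘ (5 +_)) M))))) ⟩
  _
    ≡⟨ regroup (o 0) (o 1) (o 2) (o 3) (o 4) (c 0) (c 1) (c 2) (c 3) (c 4) ⟩
  (o 0 + c 0) + ((o 1 + c 1) + ((o 2 + c 2) + ((o 3 + c 3) + (o 4 + c 4))))
    ≡⟨ cong₂ _+_ (column 0) (cong₂ _+_ (column 1) (cong₂ _+_ (column 2)
         (cong₂ _+_ (column 3) (column 4)))) ⟩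
  _ ∎
  where
  open ≡-Reasoning
  o c : ℕ → ℕ
  o j = occurrences v [ g j ]
  c j = occurrences v (applyUpTo (λ s → g (5 + (s * 5 + j))) M)

  peel : ∀ d w {k} → occurrences v w ≡ k → occurrences v (d ∷ w) ≡ occurrences v [ d ] + k
  peel d w eq = trans (occurrences-∷ v d w) (cong (occurrences v [ d ] +_) eq)

  column : ∀ j → o j + c j ≡ occurrences v (applyUpTo (λ s → g (s * 5 + j)) (suc M))
  column j = sym (occurrences-∷ v (g j) _)

  regroup : ∀ o₀ o₁ o₂ o₃ o₄ c₀ c₁ c₂ c₃ c₄ →
    o₀ + (o₁ + (o₂ + (o₃ + (o₄ + (c₀ + (c₁ + (c₂ + (c₃ + c₄)))))))) ≡
    (o₀ + c₀) + ((o₁ + c₁) + ((o₂ + c₂) + ((o₃ + c₃) + (o₄ + c₄))))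
  regroup = solve-∀

-- The representing word and its cosets.

module Construction (y : ℕ) where

  x n m : ℕ
  x = 2 + y
  n = 2 * x
  m = 2 * n

  open Modular m

  jumpSet : List ℕ
  jumpSet = x ∷ 1 ∷ n ∷ []

  -- Representatives are left unreduced, so that passing to the next block is plain `suc`; `letter`
  -- reduces them modulo `m`.
  value : ℕ → ℕ
  value 0 = 2 * x
  value 1 = 3 * x
  value 2 = 1
  value 3 = 0
  value 4 = suc x
  value (suc (suc (suc (suc (suc i))))) = suc (value i)

  value-block : ∀ s j → value (s * 5 + j) ≡ s + value j
  value-block zero j = refl
  value-block (suc s) j = cong suc (value-block s j)

  letter : ℕ → Fin m
  letter i = value i mod m

  shift-letter : ∀ i → shift 1 (letter i) ≡ letter (5 + i)
  shift-letter i = trans (shift-mod 1 (value i)) (cong (_mod m) (+-comm (value i) 1))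

  word : List (Fin m)
  word = applyUpTo letter (m * 5)

  -- Restricted to a coset of ⟨x⟩, the word cycles through r, r+x, r+2x, r+3x;
  -- next i is the position following i in that restriction.
  next : ℕ → ℕ
  next 0 = 1
  next 1 = 3
  next 2 = 4
  next 3 = suc y * 5 + 2
  next 4 = 5
  next (suc (suc (suc (suc (suc i))))) = 5 + next i

  next-block : ∀ s j → next (s * 5 + j) ≡ s * 5 + next j
  next-block zero j = refl
  next-block (suc s) j = cong (5 +_) (next-block s j)

  next-increasing : ∀ i → i < next i
  next-increasing 0 = s≤s z≤n
  next-increasing 1 = s≤s (s≤s z≤n)
  next-increasing 2 = s≤s (s≤s (s≤s z≤n))
  next-increasing 3 = s≤s (s≤s (s≤s (s≤s z≤n)))
  next-increasing 4 = s≤s (s≤s (s≤s (s≤s (s≤s z≤n))))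
  next-increasing (suc (suc (suc (suc (suc i))))) = +-monoʳ-< 5 (next-increasing i)

  letter-next : ∀ i → letter (next i) ≡ shift x (letter i)
  letter-next i = trans (%⇒mod (value (next i)) (value i + x) (value-next i)) (sym (shift-mod x (value i)))
    where
    value-next : ∀ i → value (next i) % m ≡ (value i + x) % m
    value-next 0 = cong (_% m) (identity x)
      where identity : ∀ x → 3 * x ≡ 2 * x + x
            identity = solve-∀
    value-next 1 = trans (sym (n%n≡0 m)) (cong (_% m) (identity x))
      where identity : ∀ x → 2 * (2 * x) ≡ 3 * x + x
            identity = solve-∀
    value-next 2 = refl
    -- After 0 in column 3 the coset continues with x, found in column 2 of block x - 1 = `suc y`,
    -- as that column holds the block index plus 1.
    value-next 3 = cong (_% m) (trans (value-block (suc y) 2) (cong suc (+-comm y 1)))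
    value-next 4 = cong (_% m) (identity x)
      where identity : ∀ x → suc (2 * x) ≡ suc x + x
            identity = solve-∀
    value-next (suc (suc (suc (suc (suc i))))) = begin
      (1 + value (next i)) % m     ≡⟨ cong (_% m) (+-comm 1 (value (next i))) ⟩
      (value (next i) + 1) % m     ≡⟨ %-cong-+ʳ (value (next i)) (value i + x) 1 (value-next i) ⟩
      (value i + x + 1) % m        ≡⟨ cong (_% m) (+-comm (value i + x) 1) ⟩
      (1 + value i + x) % m        ∎
      where open ≡-Reasoning

  -- Linear forms p + q y: the comparisons needed for the 25 pairs of columns
  -- hold coefficientwise, so a decision procedure can check them for all y at once.
  Form : Set
  Form = ℕ × ℕ

  infix 8 ⟦_⟧
  ⟦_⟧ : Form → ℕ
  ⟦ p , q ⟧ = p + q * y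

  infixl 6 _⊕_ _⊖_
  _⊕_ _⊖_ : Form → Form → Form
  (p , q) ⊕ (p′ , q′) = p + p′ , q + q′
  (p , q) ⊖ (p′ , q′) = p ∸ p′ , q ∸ q′

  ⊕-homo : ∀ f f′ → ⟦ f ⊕ f′ ⟧ ≡ ⟦ f ⟧ + ⟦ f′ ⟧
  ⊕-homo (p , q) (p′ , q′) = identity p q p′ q′ y
    where
    identity : ∀ p q p′ q′ y → p + p′ + (q + q′) * y ≡ p + q * y + (p′ + q′ * y)
    identity = solve-∀

  ⟦⟧-mono : ∀ {p q p′ q′} → p ≤ p′ → q ≤ q′ → ⟦ p , q ⟧ ≤ ⟦ p′ , q′ ⟧
  ⟦⟧-mono p≤p′ q≤q′ = +-mono-≤ p≤p′ (*-monoˡ-≤ y q≤q′)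

  modulus : Form
  modulus = 8 , 4

  -- `offset j` is the form of `value j`. `return j` is the form of the position where the letter at
  -- position `j` comes back after four steps of `next`, since 4x = m.
  offset return : Fin 5 → Form
  offset 0F = 4 , 2
  offset 1F = 6 , 3
  offset 2F = 1 , 0
  offset 3F = 0 , 0
  offset 4F = 3 , 1
  return 0F = 9 , 5
  return 1F = 10 , 5
  return 2F = 8 , 0
  return 3F = 11 , 5
  return 4F = 12 , 5

  value-offset : ∀ j → value (toℕ j) ≡ ⟦ offset j ⟧
  value-offset 0F = identity y
    where identity : ∀ y → 2 * (2 + y) ≡ 4 + 2 * y
          identity = solve-∀
  value-offset 1F = identity y
    where identity : ∀ y → 3 * (2 + y) ≡ 6 + 3 * y
          identity = solve-∀
  value-offset 2F = refl
  value-offset 3F = refl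
  value-offset 4F = identity y
    where identity : ∀ y → 3 + y ≡ 3 + 1 * y
          identity = solve-∀

  m-form : m ≡ ⟦ modulus ⟧
  m-form = identity y
    where identity : ∀ y → 2 * (2 * (2 + y)) ≡ 8 + 4 * y
          identity = solve-∀

  -- Consecutive occurrences of a letter.

  next⁴ : ℕ → ℕ
  next⁴ i = next (next (next (next i)))

  next⁴-return : ∀ j → next⁴ (toℕ j) ≡ ⟦ return j ⟧
  next⁴-return 0F = trans (next-block (suc y) 2) (identity y)
    where identity : ∀ y → suc y * 5 + 4 ≡ 9 + 5 * y
          identity = solve-∀
  next⁴-return 1F = trans (cong next (next-block (suc y) 2))
    (trans (next-block (suc y) 4) (identity y))
    where identity : ∀ y → suc y * 5 + 5 ≡ 10 + 5 * y
          identity = solve-∀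
  next⁴-return 2F = refl
  next⁴-return 3F = trans (cong (next ∘ next) (next-block (suc y) 2))
    (trans (cong next (next-block (suc y) 4)) (trans (next-block (suc y) 5) (identity y)))
    where identity : ∀ y → suc y * 5 + 6 ≡ 11 + 5 * y
          identity = solve-∀
  next⁴-return 4F = identity y
    where identity : ∀ y → 5 + (suc y * 5 + 2) ≡ 12 + 5 * y
          identity = solve-∀

  -- The number of blocks from v in column j to the next block having v in
  -- column j′, where the same block counts as next if j ≠ j′.
  delay : Fin 5 → Fin 5 → Form
  delay j j′ with proj₁ (offset j′) <? proj₁ (offset j)
  ... | yes _ = offset j ⊖ offset j′
  ... | no _ = (offset j ⊕ modulus) ⊖ offset j′

  -- The first clause makes `d` the right residue and certifies that the truncated subtraction in
  -- `delay` lost nothing. The second makes it the least residue, or `m` itself within one column.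
  -- The third says that column `j′` of block `d` is not before `return j`.
  Delayed : Fin 5 → Fin 5 → Form → Set
  Delayed j j′ d@(p , q) =
    (d ⊕ offset j′ ≡ offset j ⊎ d ⊕ offset j′ ≡ offset j ⊕ modulus) ×
    ((p < 8 × q ≤ 4) ⊎ (j ≡ j′ × d ≡ modulus)) ×
    (proj₁ (return j) ≤ p * 5 + toℕ j′ × proj₂ (return j) ≤ q * 5)

  delayed : ∀ j j′ → Delayed j j′ (delay j j′)
  delayed = from-yes (all? λ j → all? λ j′ → delayed? j j′ (delay j j′))
    where
    infix 4 _≟ᶠ_
    _≟ᶠ_ = ≡-dec ℕ._≟_ ℕ._≟_
    delayed? : ∀ j j′ d → Dec (Delayed j j′ d)
    delayed? j j′ d@(p , q) =
      ((d ⊕ offset j′ ≟ᶠ offset j) ⊎-dec (d ⊕ offset j′ ≟ᶠ offset j ⊕ modulus)) ×-dec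
      (((p <? 8) ×-dec (q ≤? 4)) ⊎-dec ((j ≟ j′) ×-dec (d ≟ᶠ modulus))) ×-dec
      ((proj₁ (return j) ≤? p * 5 + toℕ j′) ×-dec (proj₂ (return j) ≤? q * 5))

  private
    -- The later occurrence lies in column `j′` of some block `e`, and equality of letters forces
    -- `e` to be congruent to the delay `d`. Minimality of `d` gives `d ≤ e`, and the bound at block
    -- `d` then carries over to block `e`.
    return-base : ∀ j {i′} → letter (toℕ j) ≡ letter i′ → toℕ j < i′ → next⁴ (toℕ j) ≤ i′
    return-base j {i′} same j<i′ with result e j′ refl ← i′ divMod 5
      with congruent , small , enough₁ , enough₂ ← delayed j j′ = begin
      next⁴ (toℕ j)                      ≡⟨ next⁴-return j ⟩
      ⟦ return j ⟧                       ≤⟨ ⟦⟧-mono enough₁ enough₂ ⟩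
      ⟦ p * 5 + toℕ j′ , q * 5 ⟧         ≡⟨ identity p q (toℕ j′) y ⟩
      toℕ j′ + ⟦ d ⟧ * 5                 ≤⟨ +-monoʳ-≤ (toℕ j′) (*-monoˡ-≤ 5 (d≤e small)) ⟩
      toℕ j′ + e * 5                     ∎
      where
      open ≤-Reasoning
      d : Form
      d = delay j j′
      p q : ℕ
      p = proj₁ d
      q = proj₂ d

      identity : ∀ p q k y → p * 5 + k + q * 5 * y ≡ k + (p + q * y) * 5
      identity = solve-∀

      d+value : ⟦ d ⟧ + value (toℕ j′) ≡ ⟦ d ⊕ offset j′ ⟧
      d+value = trans (cong (⟦ d ⟧ +_) (value-offset j′)) (sym (⊕-homo d (offset j′)))

      d-congruent : d ⊕ offset j′ ≡ offset j ⊎ d ⊕ offset j′ ≡ offset j ⊕ modulus →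
        (⟦ d ⟧ + value (toℕ j′)) % m ≡ value (toℕ j) % m
      d-congruent (inj₁ eq) = cong (_% m) (trans d+value (trans (cong ⟦_⟧ eq) (sym (value-offset j))))
      d-congruent (inj₂ eq) = trans (cong (_% m) (trans d+value (trans (cong ⟦_⟧ eq)
        (trans (⊕-homo (offset j) modulus) (sym (cong₂ _+_ (value-offset j) m-form))))))
        ([m+n]%n≡m%n (value (toℕ j)) m)

      d≡e : ⟦ d ⟧ % m ≡ e % m
      d≡e = %-cancel-+ʳ ⟦ d ⟧ e (value (toℕ j′)) (trans (d-congruent congruent) (trans
        (mod⇒% (value (toℕ j)) (value (toℕ j′ + e * 5)) same)
        (cong (_% m) (trans (cong value (+-comm (toℕ j′) (e * 5))) (value-block e (toℕ j′))))))

      d≤e : (p < 8 × q ≤ 4) ⊎ (j ≡ j′ × d ≡ modulus) → ⟦ d ⟧ ≤ e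
      d≤e (inj₁ (p<8 , q≤4)) = subst (_≤ e) (trans (sym d≡e) (m<n⇒m%n≡m d<m)) (m%n≤m e m)
        where
        d<m : ⟦ d ⟧ < m
        d<m = subst (⟦ d ⟧ <_) (sym m-form) (+-mono-<-≤ p<8 (*-monoˡ-≤ y q≤4))
      -- Within one column `e` is a multiple of `m`, and it is nonzero because `i′` lies strictly
      -- after `j`.
      d≤e (inj₂ (refl , d≡modulus)) =
        subst (_≤ e) d≡m (∣⇒≤ {{e≢0}} (m%n≡0⇒n∣m e m (trans (sym d≡e)
          (trans (cong (_% m) (sym d≡m)) (n%n≡0 m)))))
        where
        d≡m : m ≡ ⟦ d ⟧
        d≡m = trans m-form (cong ⟦_⟧ (sym d≡modulus))
        e≢0 : NonZero e
        e≢0 = ≢-nonZero λ { refl → <-irrefl (sym (+-identityʳ (toℕ j))) j<i′ }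

  -- No letter recurs before a full cycle through its coset. Only the first block needs an argument:
  -- moving five places on rotates all letters by 1.
  next⁴-≤ : ∀ i {i′} → letter i ≡ letter i′ → i < i′ → next⁴ i ≤ i′
  next⁴-≤ 0 = return-base 0F
  next⁴-≤ 1 = return-base 1F
  next⁴-≤ 2 = return-base 2F
  next⁴-≤ 3 = return-base 3F
  next⁴-≤ 4 = return-base 4F
  next⁴-≤ (suc (suc (suc (suc (suc i))))) {suc (suc (suc (suc (suc i′))))}
    same (s<s (s<s (s<s (s<s (s<s i<i′))))) =
    +-monoʳ-≤ 5 (next⁴-≤ i (shift-injective 1
      (trans (shift-letter i) (trans same (sym (shift-letter i′))))) i<i′)

  -- Six exceeds the five places from v to v + 1, so v + 1 falls strictly before v recurs. Column 2
  -- attains the bound.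
  next⁴-gap : ∀ i → 6 + i ≤ next⁴ i
  next⁴-gap 0 = ≤-trans (≤ᵇ⇒≤ 6 9 _) (≤-trans (m≤m+n 9 _) (≤-reflexive (sym (next⁴-return 0F))))
  next⁴-gap 1 = ≤-trans (≤ᵇ⇒≤ 7 10 _) (≤-trans (m≤m+n 10 _) (≤-reflexive (sym (next⁴-return 1F))))
  next⁴-gap 2 = ≤-refl
  next⁴-gap 3 = ≤-trans (≤ᵇ⇒≤ 9 11 _) (≤-trans (m≤m+n 11 _) (≤-reflexive (sym (next⁴-return 3F))))
  next⁴-gap 4 = ≤-trans (≤ᵇ⇒≤ 10 12 _) (≤-trans (m≤m+n 12 _) (≤-reflexive (sym (next⁴-return 4F))))
  next⁴-gap (suc (suc (suc (suc (suc i))))) = +-monoʳ-≤ 5 (next⁴-gap i)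

  -- Adjacent vertices alternate.

  separated-by : ∀ {M a b} (step : ℕ → ℕ) → (∀ i → i < step i) → (∀ i → step i < next⁴ i) →
    (∀ i → letter i ≡ a → letter (step i) ≡ b) → Separated letter M a b
  -- The `b` at `step i` comes before `next⁴ i`, and by `next⁴-≤` no later `a` stands before
  -- `next⁴ i`.
  separated-by step i<step step<next⁴ letter-step {i} i<j _ li lj =
    step i , i<step i , <-≤-trans (step<next⁴ i) (next⁴-≤ i (trans li (sym lj)) i<j) ,
    letter-step i li

  letter-next² : ∀ i → letter (next (next i)) ≡ shift n (letter i)
  letter-next² i = begin
    letter (next (next i))            ≡⟨ letter-next (next i) ⟩
    shift x (letter (next i))         ≡⟨ cong (shift x) (letter-next i) ⟩
    shift x (shift x (letter i))      ≡⟨ shift-shift x x (letter i) ⟩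
    shift (x + x) (letter i)          ≡⟨ cong (λ t → shift (x + t) (letter i)) (+-identityʳ x) ⟨
    shift n (letter i)                ∎
    where open ≡-Reasoning

  letter-next³ : ∀ i → letter (next (next (next i))) ≡ shift (x + n) (letter i)
  letter-next³ i = begin
    letter (next (next (next i)))     ≡⟨ letter-next² (next i) ⟩
    shift n (letter (next i))         ≡⟨ cong (shift n) (letter-next i) ⟩
    shift n (shift x (letter i))      ≡⟨ shift-shift n x (letter i) ⟩
    shift (x + n) (letter i)          ∎
    where open ≡-Reasoning

  separated-x : ∀ {M a b} → shift x a ≡ b → Separated letter M a b
  separated-x a→b = separated-by next next-increasing
    (λ i → <-trans (next-increasing _) (<-trans (next-increasing _) (next-increasing _)))
    λ i li → trans (letter-next i) (trans (cong (shift x) li) a→b)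

  separated-n : ∀ {M a b} → shift n a ≡ b → Separated letter M a b
  separated-n a→b = separated-by (next ∘ next)
    (λ i → <-trans (next-increasing _) (next-increasing _))
    (λ i → <-trans (next-increasing _) (next-increasing _))
    λ i li → trans (letter-next² i) (trans (cong (shift n) li) a→b)

  -- As x + n = 3x is -x modulo 4x, three steps of `next` serve the jump `x` taken backwards.
  separated-x+n : ∀ {M a b} → shift (x + n) a ≡ b → Separated letter M a b
  separated-x+n a→b = separated-by (next ∘ next ∘ next)
    (λ i → <-trans (next-increasing _) (<-trans (next-increasing _) (next-increasing _)))
    (λ i → next-increasing _)
    λ i li → trans (letter-next³ i) (trans (cong (shift (x + n)) li) a→b)

  separated-1 : ∀ {M a b} → shift 1 a ≡ b → Separated letter M a b
  separated-1 a→b = separated-by (5 +_) (λ i → m<n+m i z<s) next⁴-gap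
    λ i li → trans (sym (shift-letter i)) (trans (cong (shift 1) li) a→b)

  -- Five places before the second `b` stands an `a`; the gap of at least six between the two `b`s
  -- keeps it after the first.
  separated-1⁻¹ : ∀ {M a b} → shift 1 a ≡ b → Separated letter M b a
  separated-1⁻¹ a→b {i} {j} i<j _ li lj
    with j | ≤-trans (next⁴-gap i) (next⁴-≤ i (trans li (sym lj)) i<j) | lj
  ... | suc (suc (suc (suc (suc k)))) | s≤s (s≤s (s≤s (s≤s (s≤s i<k)))) | lk =
    k , i<k , m<n+m k z<s ,
    shift-injective 1 (trans (shift-letter k) (trans lk (sym a→b)))

  step⇒separated : ∀ {δ a b} → δ ∈ jumpSet → shift δ a ≡ b →
    Separated letter (m * 5) a b × Separated letter (m * 5) b a
  step⇒separated (here refl) a→b =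
    separated-x a→b , separated-x+n (shift-back x (x + n) (identity x) a→b)
    where identity : ∀ x → x + (x + 2 * x) ≡ 2 * (2 * x)
          identity = solve-∀
  step⇒separated (there (here refl)) a→b = separated-1 a→b , separated-1⁻¹ a→b
  step⇒separated (there (there (here refl))) a→b =
    separated-n a→b , separated-n (shift-back n n (cong (n +_) (sym (+-identityʳ n))) a→b)

  near⇒alternate : ∀ {a b} → Near jumpSet a b → Alternate a b word
  near⇒alternate (δ , δ∈ , inj₁ step) =
    let sep , sep′ = step⇒separated δ∈ step in separated⇒alternate letter (m * 5) sep sep′
  near⇒alternate (δ , δ∈ , inj₂ step) =
    let sep , sep′ = step⇒separated δ∈ step in separated⇒alternate letter (m * 5) sep′ sep

  -- Alternating vertices are adjacent.

  near-between : ∀ s {k} → s * 5 + 2 < k → k < s * 5 + 8 →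
    Near jumpSet (letter (s * 5 + 2)) (letter k)
  near-between zero {0} () _
  near-between zero {1} (s≤s ()) _
  near-between zero {2} (s≤s (s≤s ())) _
  -- Positions 2 and 8 both carry 1. Positions 3 to 7 carry 0, 1 + x, 1 + n, 1 + 3x and 2, the
  -- neighbours of 1 by the jumps -1, x, n, -x and 1.
  near-between zero {3} _ _ = 1 , there (here refl) , inj₂ (shift-mod 1 0)
  near-between zero {4} _ _ = x , here refl , inj₁ (shift-mod x 1)
  near-between zero {5} _ _ = n , there (there (here refl)) , inj₁ (shift-mod n 1)
  near-between zero {6} _ _ = x , here refl , inj₂ (trans (shift-mod x (suc (3 * x)))
    (%⇒mod (suc (3 * x) + x) 1 (trans (cong (_% m) (identity x)) ([m+n]%n≡m%n 1 m))))
    where identity : ∀ x → suc (3 * x) + x ≡ 1 + 2 * (2 * x)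
          identity = solve-∀
  near-between zero {7} _ _ = 1 , there (here refl) , inj₁ (shift-mod 1 1)
  near-between zero {suc (suc (suc (suc (suc (suc (suc (suc k)))))))} _
    (s≤s (s≤s (s≤s (s≤s (s≤s (s≤s (s≤s (s≤s ()))))))))
  near-between (suc s) {suc (suc (suc (suc (suc k))))}
    (s≤s (s≤s (s≤s (s≤s (s≤s lower))))) (s≤s (s≤s (s≤s (s≤s (s≤s upper))))) =
    subst₂ (Near jumpSet) (shift-letter (s * 5 + 2)) (shift-letter k)
      (near-shift 1 (near-between s lower upper))

  -- The vertex s + 1 stands in column 2 of block s and in column 3 of block s + 1, so an
  -- alternating `b` must occur between these places. Positivity of `a` keeps the two blocks on the
  -- same side of the cut.
  alternate⇒near-suc : ∀ s {a b} → toℕ a ≡ suc s → a ≢ b → Alternate a b word → Near jumpSet a b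
  alternate⇒near-suc s {a} {b} a≡ a≢b alt =
    let k , lower , upper , lk = alternate⇒separated a≢b letter (m * 5) alt
          {s * 5 + 2} {s * 5 + 8} (+-monoʳ-< (s * 5) (≤ᵇ⇒≤ 3 8 _)) end (first 2 refl) (first 8 refl)
    in subst₂ (Near jumpSet) (first 2 refl) lk (near-between s lower upper)
    where
    first : ∀ j → value j ≡ 1 → letter (s * 5 + j) ≡ a
    first j vj≡1 = trans (cong (_mod m) (begin
      value (s * 5 + j)      ≡⟨ value-block s j ⟩
      s + value j            ≡⟨ cong (s +_) vj≡1 ⟩
      s + 1                  ≡⟨ +-comm s 1 ⟩
      suc s                  ≡⟨ a≡ ⟨
      toℕ a                  ∎)) (mod-toℕ a)
      where open ≡-Reasoning
    end : s * 5 + 8 < m * 5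
    end = begin-strict
      s * 5 + 8              <⟨ +-monoʳ-< (s * 5) (≤ᵇ⇒≤ 9 10 _) ⟩
      s * 5 + 10             ≡⟨ +-comm (s * 5) 10 ⟩
      suc (suc s) * 5        ≤⟨ *-monoˡ-≤ 5 (subst (_< m) a≡ (toℕ<n a)) ⟩
      m * 5                  ∎
      where open ≤-Reasoning

  alternate⇒near : ∀ {a b} → a ≢ b → Alternate a b word → Near jumpSet a b
  alternate⇒near {a} {b} a≢b alt = by-cases (toℕ a) (toℕ b) refl refl
    where
    by-cases : ∀ s t → toℕ a ≡ s → toℕ b ≡ t → Near jumpSet a b
    by-cases (suc s) _ a≡ _ = alternate⇒near-suc s a≡ a≢b alt
    by-cases zero (suc t) _ b≡ =
      near-sym (alternate⇒near-suc t b≡ (a≢b ∘ sym) (alternate-sym word alt))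
    by-cases zero zero a≡ b≡ = contradiction (toℕ-injective (trans a≡ (sym b≡))) a≢b

  -- Uniformity, completeness and the edge relation.

  word-uniform : Uniform 5 word
  word-uniform v = trans (occurrences-columns v letter m)
    (cong₂ _+_ (column 0) (cong₂ _+_ (column 1) (cong₂ _+_ (column 2)
      (cong₂ _+_ (column 3) (column 4)))))
    where
    column : ∀ j → occurrences v (applyUpTo (λ s → letter (s * 5 + j)) m) ≡ 1
    column j = occurrences-progression (value j) (λ s → cong (_mod m) (value-block s j)) v

  -- Column 3 has offset 0, so block `v` shows `v` itself there.
  word-complete : ∀ v → v ∈ word
  word-complete v = subst (_∈ word) (letter-v) (∈-applyUpTo⁺ letter position)
    where
    letter-v : letter (toℕ v * 5 + 3) ≡ v
    letter-v = trans (cong (_mod m) (trans (value-block (toℕ v) 3) (+-identityʳ (toℕ v)))) (mod-toℕ v)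
    position : toℕ v * 5 + 3 < m * 5
    position = begin-strict
      toℕ v * 5 + 3          <⟨ +-monoʳ-< (toℕ v * 5) (≤ᵇ⇒≤ 4 5 _) ⟩
      toℕ v * 5 + 5          ≡⟨ +-comm (toℕ v * 5) 5 ⟩
      suc (toℕ v) * 5        ≤⟨ *-monoˡ-≤ 5 (toℕ<n v) ⟩
      m * 5                  ∎
      where open ≤-Reasoning

  jump-bounds : All (λ δ → 2 * δ ≤ m) jumpSet
  jump-bounds = *-monoʳ-≤ 2 (m≤n*m x 2) ∷ *-monoʳ-≤ 2 {x = 1} {y = n} z<s ∷ ≤-refl ∷ []

  distance⇔alternate : ∀ a b → a ≢ b → circularDistance a b ∈ jumpSet ⇔ Alternate a b word
  distance⇔alternate a b a≢b = mk⇔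
    (λ d∈ → near⇒alternate (_ , d∈ , shift-distance a b))
    (λ alt → near⇒distance jump-bounds (alternate⇒near a≢b alt))

theorem28 : (n x : ℕ) (1<x : 1 < x) (x<n : x < n) → 2 * x ≡ n →
    WordRepresentable (C₂ₙ[ x ,1, n ] 1<x x<n) ×
    (∃[ r ] (IsRepresentationNumber (C₂ₙ[ x ,1, n ] 1<x x<n) r × r ≤ 5))
-- Matching `refl` turns `n` into `2 * x` with `x` equal to `2 + y`, so that `G` has by computation
-- the order and jump set of `Construction y`. The 5-uniform word then bounds the search for the
-- least `k`.
theorem28 n x@(suc (suc y)) 1<x@(s≤s (s≤s z≤n)) x<n refl =
  (word , represents) , least (representable? G adj?) 5 (word , word-uniform , represents)
  where
  open Construction y using (word; word-uniform; word-complete; distance⇔alternate; jumpSet)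
  G : Graph
  G = C₂ₙ[ x ,1, n ] 1<x x<n
  adj? : ∀ u v → Dec (Adj G u v)
  adj? u v = _∈?_ ℕ._≟_ (circularDistance u v) jumpSet
  represents : Represents G word
  represents = word-complete , distance⇔alternate
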